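{- There is a finite relational signature $\sigma$ such that order-invariance is undecidable on $\mathrm{Fin}_{\sigma,2}$; that is, there is no algorithm which, given a sentence $\varphi\in\mathrm{FO}[\sigma\cup\{\le\}]$, decides whether $\varphi$ is order-invariant on $\mathrm{Fin}_{\sigma,2}$.
   Context: Tree-depth: for a finite simple graph $G$, $\operatorname{td}(G)=1$ if $|V(G)|=1$; $\operatorname{td}(G)=1+\min_{r\in V(G)}\operatorname{td}(G\setminus r)$ if $G$ is connected and $|V(G)|>1$; $\operatorname{td}(G)=\max_i \operatorname{td}(K_i)$ if $G$ is disconnected with components $K_1,\dots,K_n$. The Gaifman graph of a $\sigma$-structure $\mathfrak A$ has the universe $A$ as vertex set, with an edge between distinct $x,y$ iff they occur together in a tuple of some relation of $\mathfrak A$. The tree-depth of $\mathfrak A$ is that of its Gaifman graph. $\mathrm{Fin}_{\sigma,d}$ is the class of finite $\sigma$-structures of tree-depth at most $d$. Let $\le$ be a binary relation symbol not in $\sigma$. An ordered expansion $(\mathfrak A,\preceq)$ of a $\sigma$-structure $\mathfrak A$ is its expansion to a $\sigma\cup\{\le\}$-structure interpreting $\le$ by a linear order $\preceq$ on $A$. A sentence $\varphi\in \mathrm{FO}[\sigma\cup\{\le\}]$ (first-order logic) is order-invariant on a class $\mathcal C$ of $\sigma$-structures if for all $\mathfrak A\in\mathcal C$ and all ordered expansions $(\mathfrak A,\preceq_1),(\mathfrak A,\preceq_2)$ of $\mathfrak A$: $(\mathfrak A,\preceq_1)\models\varphi$ iff $(\mathfrak A,\preceq_2)\models\varphi$. 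-}

module Defs where

open import Data.Bool using (Bool; T)
open import Data.Fin using (Fin; zero; suc; toℕ)
open import Data.Fin.Subset using (Subset; _∈_; _-_; ∣_∣; ⊤)
open import Data.Nat using (ℕ; zero; suc; _+_; _≤_; _<_)
open import Data.Product using (Σ; ∃; ∃-syntax; _×_; _,_)
open import Data.Sum using (_⊎_)
open import Data.Vec using (Vec; []; _∷_; lookup; map)
import Data.Vec.Membership.Propositional as Vec
open import Function.Bundles using (_⇔_)
open import Relation.Binary.Construct.Closure.ReflexiveTransitive using (Star)
open import Relation.Binary.Structures using (IsTotalOrder)
open import Relation.Binary.PropositionalEquality using (_≡_; _≢_; refl; sym)
open import Relation.Nullary using (¬_)

------------------------------------------------------------------------
-- Graphs and tree-depth

record Graph (n : ℕ) : Set₁ where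
  field
    _~_      : Fin n → Fin n → Set
    ~-sym    : ∀ {u v} → u ~ v → v ~ u
    ~-irrefl : ∀ {v} → ¬ (v ~ v)

IsMin : {A : Set} → (A → Set) → (A → ℕ) → ℕ → Set
IsMin P f m = (∃[ x ] P x × f x ≡ m) × (∀ x → P x → m ≤ f x)

IsMax : {A : Set} → (A → Set) → (A → ℕ) → ℕ → Set
IsMax P f m = (∃[ x ] P x × f x ≡ m) × (∀ x → P x → f x ≤ m)

module _ {n : ℕ} (G : Graph n) where
  open Graph G

  -- A vertex set S stands for the subgraph of G induced by S.

  Edge : Subset n → Fin n → Fin n → Set
  Edge S u v = u ∈ S × v ∈ S × u ~ v

  Reachable : Subset n → Fin n → Fin n → Set
  Reachable S = Star (Edge S)

  Connected : Subset n → Set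
  Connected S = ∀ {u v} → u ∈ S → v ∈ S → Reachable S u v

  Component : Subset n → Subset n → Set
  Component S K = ∃[ v ] v ∈ S × (∀ w → w ∈ K ⇔ Reachable S v w)

  -- TreeDepth S k is the graph of the function S ↦ td(G[S]), which is
  -- defined on nonempty S.  In the last two constructors t lists the values
  -- of td on the smaller subgraphs; only its values at r ∈ S, respectively
  -- at the components of S, matter.
  data TreeDepth : Subset n → ℕ → Set where
    single       : ∀ {S} → ∣ S ∣ ≡ 1 → TreeDepth S 1
    connected    : ∀ {S m} → Connected S → 1 < ∣ S ∣ →
                   (t : Fin n → ℕ) →
                   (∀ r → r ∈ S → TreeDepth (S - r) (t r)) →
                   IsMin (_∈ S) t m →
                   TreeDepth S (1 + m)
    disconnected : ∀ {S m} → ¬ Connected S →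
                   (t : Subset n → ℕ) →
                   (∀ K → Component S K → TreeDepth K (t K)) →
                   IsMax (Component S) t m →
                   TreeDepth S m

------------------------------------------------------------------------
-- Finite relational signatures, finite structures, first-order logic

record Signature : Set where
  field
    size  : ℕ
    arity : Fin size → ℕ

open Signature public

-- Every finite nonempty structure is isomorphic to one with universe
-- {0,…,k}; relations are given by characteristic functions.
record Structure (σ : Signature) : Set where
  field
    pred-card : ℕ
  Universe : Set
  Universe = Fin (suc pred-card)
  field
    rel : (R : Fin (size σ)) → Vec Universe (arity σ R) → Bool

open Structure public

infix  9 _≐_
infix  8 ¬̇_
infixr 7 _∧̇_
infixr 6 _∨̇_
infixr 5 _⇒̇_

-- Formulas whose free variables are among n de Bruijn indices.
data Formula (σ : Signature) (n : ℕ) : Set where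
  atom    : (R : Fin (size σ)) → Vec (Fin n) (arity σ R) → Formula σ n
  _≐_     : Fin n → Fin n → Formula σ n
  ¬̇_      : Formula σ n → Formula σ n
  _∧̇_     : Formula σ n → Formula σ n → Formula σ n
  _∨̇_     : Formula σ n → Formula σ n → Formula σ n
  _⇒̇_     : Formula σ n → Formula σ n → Formula σ n
  ∃̇_ ∀̇_   : Formula σ (suc n) → Formula σ n

Sentence : Signature → Set
Sentence σ = Formula σ 0

Sat : ∀ {σ n} (A : Structure σ) → Vec (Universe A) n → Formula σ n → Set
Sat A ρ (atom R xs) = T (rel A R (map (lookup ρ) xs))
Sat A ρ (x ≐ y)     = lookup ρ x ≡ lookup ρ y
Sat A ρ (¬̇ φ)       = ¬ Sat A ρ φ
Sat A ρ (φ ∧̇ ψ)     = Sat A ρ φ × Sat A ρ ψ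
Sat A ρ (φ ∨̇ ψ)     = Sat A ρ φ ⊎ Sat A ρ ψ
Sat A ρ (φ ⇒̇ ψ)     = Sat A ρ φ → Sat A ρ ψ
Sat A ρ (∃̇ φ)       = ∃[ a ] Sat A (a ∷ ρ) φ
Sat A ρ (∀̇ φ)       = ∀ a → Sat A (a ∷ ρ) φ

infix 4 _⊨_

_⊨_ : ∀ {σ} → Structure σ → Sentence σ → Set
A ⊨ φ = Sat A [] φ

------------------------------------------------------------------------
-- The class Fin_{σ,d}

Gaifman : ∀ {σ} (A : Structure σ) → Graph (suc (pred-card A))
Gaifman {σ} A = record
  { _~_      = λ x y → x ≢ y × ∃[ R ] Σ (Vec (Universe A) (arity σ R)) λ as →
                 T (rel A R as) × x Vec.∈ as × y Vec.∈ as
  ; ~-sym    = λ (x≢y , R , as , h , x∈ , y∈) →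
                 (λ y≡x → x≢y (sym y≡x)) , R , as , h , y∈ , x∈
  ; ~-irrefl = λ (v≢v , _) → v≢v refl
  }

FinTD : (σ : Signature) → ℕ → Structure σ → Set
FinTD σ d A = ∃[ k ] TreeDepth (Gaifman A) ⊤ k × k ≤ d

------------------------------------------------------------------------
-- Order-invariance

-- σ ∪ {≤}: symbol zero is ≤, symbol suc R is the symbol R of σ.
_∪≤ : Signature → Signature
size  (σ ∪≤)         = suc (size σ)
arity (σ ∪≤) zero    = 2
arity (σ ∪≤) (suc R) = arity σ R

LinearOrder : ∀ {A : Set} → (A → A → Bool) → Set
LinearOrder _≼_ = IsTotalOrder _≡_ (λ x y → T (x ≼ y))

expand : ∀ {σ} (A : Structure σ) →
         (Universe A → Universe A → Bool) → Structure (σ ∪≤)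
expand {σ} A _≼_ = record { pred-card = pred-card A ; rel = rel′ }
  where
  rel′ : (R : Fin (size (σ ∪≤))) → Vec (Universe A) (arity (σ ∪≤) R) → Bool
  rel′ zero    (x ∷ y ∷ []) = x ≼ y
  rel′ (suc R) as           = rel A R as

OrderInvariantOn : ∀ {σ} → (Structure σ → Set) → Sentence (σ ∪≤) → Set
OrderInvariantOn C φ =
  ∀ A → C A → ∀ _≼₁_ _≼₂_ → LinearOrder _≼₁_ → LinearOrder _≼₂_ →
  (expand A _≼₁_ ⊨ φ) ⇔ (expand A _≼₂_ ⊨ φ)

------------------------------------------------------------------------
-- μ-recursive functions

data Rec : ℕ → Set where
  zer  : Rec 0
  succ : Rec 1
  proj : ∀ {n} → Fin n → Rec n
  comp : ∀ {m n} → Rec m → Vec (Rec n) m → Rec n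
  prec : ∀ {n} → Rec n → Rec (2 + n) → Rec (1 + n)
  mu   : ∀ {n} → Rec (1 + n) → Rec n

infix 4 _[_]⇓_

-- f [ xs ]⇓ y: the partial function denoted by f is defined at xs with
-- value y.
data _[_]⇓_ : ∀ {n} → Rec n → Vec ℕ n → ℕ → Set where
  zer⇓   : zer [ [] ]⇓ 0
  succ⇓  : ∀ {x} → succ [ x ∷ [] ]⇓ suc x
  proj⇓  : ∀ {n} {i : Fin n} {xs} → proj i [ xs ]⇓ lookup xs i
  comp⇓  : ∀ {m n} {f : Rec m} {gs : Vec (Rec n) m} {xs ys z} →
           (∀ i → lookup gs i [ xs ]⇓ lookup ys i) →
           f [ ys ]⇓ z →
           comp f gs [ xs ]⇓ z
  prec⇓0 : ∀ {n} {f : Rec n} {g xs y} →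
           f [ xs ]⇓ y →
           prec f g [ 0 ∷ xs ]⇓ y
  prec⇓s : ∀ {n} {f : Rec n} {g k xs y z} →
           prec f g [ k ∷ xs ]⇓ y →
           g [ k ∷ y ∷ xs ]⇓ z →
           prec f g [ suc k ∷ xs ]⇓ z
  mu⇓    : ∀ {n} {f : Rec (1 + n)} {xs k} →
           (∀ j → j < k → ∃[ v ] f [ j ∷ xs ]⇓ suc v) →
           f [ k ∷ xs ]⇓ 0 →
           mu f [ xs ]⇓ k

------------------------------------------------------------------------
-- Gödel numbering and decidability

triangle : ℕ → ℕ
triangle zero    = 0
triangle (suc n) = suc n + triangle n

-- Cantor's bijection ℕ × ℕ → ℕ.
pair : ℕ → ℕ → ℕ
pair a b = triangle (a + b) + b

codeVars : ∀ {n k} → Vec (Fin n) k → ℕ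
codeVars []       = 0
codeVars (x ∷ xs) = suc (pair (toℕ x) (codeVars xs))

⌜_⌝ : ∀ {σ n} → Formula σ n → ℕ
⌜ atom R xs ⌝ = pair 0 (pair (toℕ R) (codeVars xs))
⌜ x ≐ y ⌝     = pair 1 (pair (toℕ x) (toℕ y))
⌜ ¬̇ φ ⌝       = pair 2 ⌜ φ ⌝
⌜ φ ∧̇ ψ ⌝     = pair 3 (pair ⌜ φ ⌝ ⌜ ψ ⌝)
⌜ φ ∨̇ ψ ⌝     = pair 4 (pair ⌜ φ ⌝ ⌜ ψ ⌝)
⌜ φ ⇒̇ ψ ⌝     = pair 5 (pair ⌜ φ ⌝ ⌜ ψ ⌝)
⌜ ∃̇ φ ⌝       = pair 6 ⌜ φ ⌝
⌜ ∀̇ φ ⌝       = pair 7 ⌜ φ ⌝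

-- A decision procedure is an algorithm computing the characteristic
-- function.  Its behaviour is only prescribed on codes of sentences.
AlgorithmicallyDecidable : ∀ {σ} → (Sentence σ → Set) → Set
AlgorithmicallyDecidable P = ∃[ f ] ∀ φ →
  (P φ → f [ ⌜ φ ⌝ ∷ [] ]⇓ 1) × (¬ P φ → f [ ⌜ φ ⌝ ∷ [] ]⇓ 0)

{-# OPTIONS --safe #-}

-- In an ordered structure of tree-depth 2 a leaf can point to its centre, and
-- consecutive leaves can be read together.  Hence such structures store
-- arbitrary finite ternary relations on their elements, which the order turns
-- into an initial segment of ℕ; a ternary relation can hold the histories of
-- primitive recursions.  So every μ-recursive h has a formula that holds of n
-- in some such structure iff h(n) = 1.
--
-- Given an alleged decision procedure f, a diagonal argument gives a sentence φ
-- saying that f accepts φ and that the least element is not a last leaf of a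
-- triple.  If f accepts φ, then φ has a model, and reversing its order refutes
-- φ; so φ is not order-invariant.  If f does not accept φ, then φ has no ordered
-- model, and so is order-invariant.
module Submission where

open import Defs
open import Data.Bool using (Bool; T; T?)
open import Data.Bool.Properties using (T-≡)
open import Data.Fin as Fin using (Fin; zero; suc; toℕ; fromℕ<; _↑ˡ_; _↑ʳ_)
open import Data.Fin.Induction using (po-noetherian; po-wellFounded)
open import Data.Fin.Patterns using (0F; 1F; 2F; 3F; 4F)
import Data.Fin.Properties as Fin
open import Data.Fin.Subset using (Subset; _-_; ∣_∣; ⁅_⁆)
  renaming (_∈_ to _∈ˢ_; ⊤ to ⊤ˢ)
open import Data.Fin.Subset.Properties
  using (∈⊤; x∈⁅x⁆; x∈⁅y⁆⇒x≡y; ∣⁅x⁆∣≡1; ⊆-antisym; nonempty?; x∈p∧x≢y⇒x∈p-y; x∈p⇒∣p-x∣<∣p∣; p─q⊆p)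
open import Data.List as List using (List; []; _∷_; length; replicate)
open import Data.List.Membership.Propositional using (_∈_)
open import Data.List.Membership.Propositional.Properties
  using (∈-++⁻; ∈-++⁺ˡ; ∈-++⁺ʳ; ∈-map⁺; ∈-map⁻)
import Data.List.Properties as List
open import Data.List.Relation.Unary.All as All using (All; []; _∷_)
import Data.List.Relation.Unary.All.Properties as All
open import Data.List.Relation.Unary.Any using (here; there)
open import Data.Maybe using (Maybe; just; nothing)
import Data.Maybe.Properties as Maybe
open import Data.Nat as ℕ using (ℕ; zero; suc; _+_; _≤_; _<_; s≤s; z≤n; s<s; z<s; _≤ᵇ_)
open import Data.Nat.Induction using (<-wellFounded)
import Data.Nat.Properties as ℕ
open import Data.Product using (∃; ∃-syntax; _×_; _,_; proj₁; proj₂; map₂)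
open import Data.Product.Function.NonDependent.Propositional using (_×-⇔_)
import Data.Product.Properties as Product
open import Data.Sum as Sum using (_⊎_; inj₁; inj₂; [_,_]′)
open import Data.Sum.Function.Propositional using (_⊎-⇔_)
open import Data.Unit using (⊤; tt)
open import Data.Vec as Vec using (Vec; []; _∷_; lookup; map; _++_; tabulate)
open import Data.Vec.Properties
  using (map-++; lookup-map; map-∘; map-cong; lookup-++ʳ; lookup-++ˡ; tabulate-∘;
         tabulate∘lookup; tabulate-cong; lookup∘tabulate; []=⇒lookup; lookup⇒[]=)
open import Data.Vec.Relation.Binary.Pointwise.Inductive as Pointwise using (Pointwise; []; _∷_)
open import Data.Vec.Relation.Unary.Any using (here; there)
open import Function using (_∘_; id)
open import Function.Bundles using (_⇔_; mk⇔; Equivalence)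
open import Function.Properties.Equivalence using ()
  renaming (refl to ⇔-refl; trans to infixr 4 _∘⇔_)
open import Induction.WellFounded using (Acc; acc)
open import Relation.Binary using (tri<; tri≈; tri>; IsTotalOrder)
open import Relation.Binary.Construct.Closure.ReflexiveTransitive using (ε; _◅_; _◅◅_)
open import Relation.Binary.PropositionalEquality
  using (_≡_; _≢_; refl; sym; trans; cong; cong₂; subst; isEquivalence)
open import Relation.Nullary using (¬_; Dec; yes; no; contradiction; map′)
open import Relation.Nullary.Decidable using (_⊎-dec_; ⌊_⌋; toWitness; fromWitness)

open Equivalence using (to; from)

-- Determinism of μ-recursive functions

lookup-ext : ∀ {A : Set} {n} (xs ys : Vec A n) →
          (∀ i → lookup xs i ≡ lookup ys i) → xs ≡ ys
lookup-ext xs ys eq = trans (sym (tabulate∘lookup xs)) (trans (tabulate-cong eq) (tabulate∘lookup ys))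

⇓-deterministic : ∀ {n} {f : Rec n} {xs y y′} → f [ xs ]⇓ y → f [ xs ]⇓ y′ → y ≡ y′
⇓-deterministic zer⇓ zer⇓ = refl
⇓-deterministic succ⇓ succ⇓ = refl
⇓-deterministic proj⇓ proj⇓ = refl
⇓-deterministic (comp⇓ {ys = ys} ds d) (comp⇓ {ys = ys′} ds′ d′)
  with refl ← lookup-ext ys ys′ (λ i → ⇓-deterministic (ds i) (ds′ i)) = ⇓-deterministic d d′
⇓-deterministic (prec⇓0 d) (prec⇓0 d′) = ⇓-deterministic d d′
⇓-deterministic (prec⇓s d e) (prec⇓s d′ e′)
  with refl ← ⇓-deterministic d d′ = ⇓-deterministic e e′
⇓-deterministic (mu⇓ {k = k} hs d) (mu⇓ {k = k′} hs′ d′) with ℕ.<-cmp k k′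
... | tri< k<k′ _ _ = contradiction (⇓-deterministic d (proj₂ (hs′ k k<k′))) ℕ.0≢1+n
... | tri≈ _ k≡k′ _ = k≡k′
... | tri> _ _ k′<k = contradiction (⇓-deterministic (proj₂ (hs k′ k′<k)) d′) ℕ.1+n≢0

-- Formulas for the graphs of μ-recursive functions

-- Relation j links a leaf that carries the letter j to the centre of its star.
τ : Signature
τ = record { size = 3 ; arity = λ _ → 2 }

leq : ∀ {m} → Fin m → Fin m → Formula (τ ∪≤) m
leq x y = atom zero (x ∷ y ∷ [])

link : ∀ {m} → Fin 3 → Fin m → Fin m → Formula (τ ∪≤) m
link j x y = atom (suc j) (x ∷ y ∷ [])

isLeast : ∀ {m} → Fin m → Formula (τ ∪≤) m
isLeast x = ∀̇ leq (suc x) 0F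

isNext : ∀ {m} → Fin m → Fin m → Formula (τ ∪≤) m
isNext x y = leq x y ∧̇ (¬̇ (x ≐ y)) ∧̇ (∀̇ (leq 0F (suc x) ∨̇ leq (suc y) 0F))

-- The triple (s , i , v) is stored as three consecutive leaves of s, i and v.
fact : ∀ {m} → Fin m → Fin m → Fin m → Formula (τ ∪≤) m
fact s i v = ∃̇ ∃̇ ∃̇ (link 0F 2F (3 ↑ʳ s) ∧̇ link 1F 1F (3 ↑ʳ i) ∧̇ link 2F 0F (3 ↑ʳ v)
                     ∧̇ isNext 2F 1F ∧̇ isNext 1F 0F)

-- Recursion adds the new quantifier innermost, so that the indices `suc k + m` match
-- definitionally.
∃̇^ : ∀ {m} k → Formula (τ ∪≤) (k + m) → Formula (τ ∪≤) m
∃̇^ zero    φ = φ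
∃̇^ (suc k) φ = ∃̇^ k (∃̇ φ)

wk : ∀ {m n} k → Vec (Fin m) n → Vec (Fin (k + m)) n
wk k = map (k ↑ʳ_)

-- A primitive recursion is certified by an identifier s, whose facts (s , i , v)
-- form a set of pairs closed under going back one step of the recursion.
mutual
  graph : ∀ {n m} → Rec n → Vec (Fin m) n → Fin m → Formula (τ ∪≤) m
  graph zer      []       y = isLeast y
  graph succ     (x ∷ []) y = isNext x y
  graph (proj i) xs       y = y ≐ lookup xs i
  -- The `k` intermediate values are the newly bound variables, listed by `tabulate (_↑ˡ m)`.
  graph {m = m} (comp {k} f gs) xs y =
    ∃̇^ k (graphs gs (wk k xs) (tabulate (_↑ˡ m)) (graph f (tabulate (_↑ˡ m)) (k ↑ʳ y)))
  graph (prec f g) (k ∷ xs) y =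
    ∃̇ (fact 0F (suc k) (suc y) ∧̇
       (∀̇ ∀̇ (fact 2F 1F 0F ⇒̇
             (isLeast 1F ∧̇ graph f (wk 3 xs) 0F) ∨̇
             (∃̇ ∃̇ (fact 4F 1F 0F ∧̇ isNext 1F 3F ∧̇ graph g (1F ∷ 0F ∷ wk 5 xs) 2F)))))
  graph (mu f) xs k =
    (∃̇ (isLeast 0F ∧̇ graph f (suc k ∷ wk 1 xs) 0F)) ∧̇
    (∀̇ (leq 0F (suc k) ∧̇ (¬̇ (0F ≐ suc k)) ⇒̇
        (∃̇ ((¬̇ isLeast 0F) ∧̇ graph f (1F ∷ wk 2 xs) 0F))))

  graphs : ∀ {n m k} → Vec (Rec n) k → Vec (Fin m) n → Vec (Fin m) k →
           Formula (τ ∪≤) m → Formula (τ ∪≤) m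
  graphs []       xs []       φ = φ
  graphs (g ∷ gs) xs (y ∷ ys) φ = graph g xs y ∧̇ graphs gs xs ys φ

-- Meaning of the formulas in an ordered structure

module Semantics (B : Structure (τ ∪≤)) where

  U : Set
  U = Universe B

  infix 4 _≼_
  _≼_ : U → U → Set
  a ≼ b = T (rel B zero (a ∷ b ∷ []))

  Link : Fin 3 → U → U → Set
  Link j a b = T (rel B (suc j) (a ∷ b ∷ []))

  Least : U → Set
  Least a = ∀ b → a ≼ b

  Next : U → U → Set
  Next a b = a ≼ b × a ≢ b × (∀ c → c ≼ a ⊎ b ≼ c)

  Fact : U → U → U → Set
  Fact s i v = ∃[ a ] ∃[ b ] ∃[ c ]
    Link 0F a s × Link 1F b i × Link 2F c v × Next a b × Next b c

  mutual
    -- The meaning of `graph f`, with elements in place of de Bruijn indices; `graph-adequate`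
    -- identifies the two, and later arguments work with this form.
    Computes : ∀ {n} → Rec n → Vec U n → U → Set
    Computes zer        []       y = Least y
    Computes succ       (x ∷ []) y = Next x y
    Computes (proj i)   xs       y = y ≡ lookup xs i
    Computes (comp f gs) xs      y = ∃[ ys ] AllCompute gs xs ys × Computes f ys y
    Computes (prec f g) (k ∷ xs) y = ∃[ s ] Fact s k y × (∀ i v → Fact s i v →
      (Least i × Computes f xs v) ⊎
      (∃[ j ] ∃[ w ] Fact s j w × Next j i × Computes g (j ∷ w ∷ xs) v))
    Computes (mu f)     xs       k =
      (∃[ o ] Least o × Computes f (k ∷ xs) o) ×
      (∀ j → j ≼ k × j ≢ k → ∃[ v ] ¬ Least v × Computes f (j ∷ xs) v)

    AllCompute : ∀ {n k} → Vec (Rec n) k → Vec U n → Vec U k → Set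
    AllCompute []       xs []       = ⊤
    AllCompute (g ∷ gs) xs (y ∷ ys) = Computes g xs y × AllCompute gs xs ys

  lookup-wk : ∀ {m n k} (as : Vec U k) (ρ : Vec U m) (xs : Vec (Fin m) n) →
              map (lookup (as ++ ρ)) (wk k xs) ≡ map (lookup ρ) xs
  lookup-wk as ρ xs = trans (sym (map-∘ _ _ xs)) (map-cong (lookup-++ʳ as ρ) xs)

  lookup-new : ∀ {m k} (as : Vec U k) (ρ : Vec U m) →
               map (lookup (as ++ ρ)) (tabulate (_↑ˡ m)) ≡ as
  lookup-new as ρ = trans (sym (tabulate-∘ _ _))
    (trans (tabulate-cong (lookup-++ˡ as ρ)) (tabulate∘lookup as))

  ≡⇒⇔ : ∀ {P Q : Set} → P ≡ Q → P ⇔ Q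
  ≡⇒⇔ refl = ⇔-refl

  ∃-cong : ∀ {A : Set} {P Q : A → Set} → (∀ a → P a ⇔ Q a) → ∃ P ⇔ ∃ Q
  ∃-cong h = mk⇔ (map₂ (to (h _))) (map₂ (from (h _)))

  ∀-cong : ∀ {A : Set} {P Q : A → Set} → (∀ a → P a ⇔ Q a) → (∀ a → P a) ⇔ (∀ a → Q a)
  ∀-cong h = mk⇔ (λ p a → to (h a) (p a)) (λ q a → from (h a) (q a))

  →-cong : ∀ {A P Q : Set} → P ⇔ Q → (A → P) ⇔ (A → Q)
  →-cong h = mk⇔ (to h ∘_) (from h ∘_)

  ∃̇^-adequate : ∀ {m} k {ρ : Vec U m} {φ : Formula (τ ∪≤) (k + m)} →
                Sat B ρ (∃̇^ k φ) ⇔ (∃[ as ] Sat B (as ++ ρ) φ)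
  ∃̇^-adequate zero    = mk⇔ ([] ,_) λ { ([] , p) → p }
  ∃̇^-adequate (suc k) = ∃̇^-adequate k ∘⇔
    mk⇔ (λ (as , a , p) → a ∷ as , p) λ { (a ∷ as , p) → as , a , p }

  mutual
    graph-adequate : ∀ {n m} (f : Rec n) (ρ : Vec U m) xs y →
      Sat B ρ (graph f xs y) ⇔ Computes f (map (lookup ρ) xs) (lookup ρ y)
    graph-adequate zer ρ [] y = ⇔-refl
    graph-adequate succ ρ (x ∷ []) y = ⇔-refl
    graph-adequate (proj i) ρ xs y rewrite lookup-map i (lookup ρ) xs = ⇔-refl
    graph-adequate {m = m} (comp {k} f gs) ρ xs y = ∃̇^-adequate k ∘⇔ ∃-cong λ as →
      graphs-adequate gs (as ++ ρ) (wk k xs) (tabulate (_↑ˡ m)) ∘⇔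
      (⇔-refl ×-⇔ graph-adequate f (as ++ ρ) (tabulate (_↑ˡ m)) (k ↑ʳ y)) ∘⇔
      ≡⇒⇔ (cong₂ _×_
        (cong₂ (AllCompute gs) (lookup-wk as ρ xs) (lookup-new as ρ))
        (cong₂ (Computes f) (lookup-new as ρ) (lookup-++ʳ as ρ y)))
    graph-adequate (prec f g) ρ (k ∷ xs) y =
      ∃-cong λ s → ⇔-refl ×-⇔ ∀-cong λ i → ∀-cong λ v → →-cong
        ((⇔-refl ×-⇔ weakened f (v ∷ i ∷ s ∷ []) ρ [] xs 0F) ⊎-⇔
         (∃-cong λ j → ∃-cong λ w → ⇔-refl ×-⇔ (⇔-refl ×-⇔
           weakened g (w ∷ j ∷ v ∷ i ∷ s ∷ []) ρ (1F ∷ 0F ∷ []) xs 2F)))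
    graph-adequate (mu f) ρ xs k =
      (∃-cong λ o → ⇔-refl ×-⇔ weakened f (o ∷ []) ρ (suc k ∷ []) xs 0F) ×-⇔
      (∀-cong λ j → →-cong
        (∃-cong λ v → ⇔-refl ×-⇔ weakened f (v ∷ j ∷ []) ρ (1F ∷ []) xs 0F))

    -- The case of adequacy that occurs under the binders of `prec` and `mu`: some arguments are
    -- chosen in the extended context, the others are weakened from the old one.
    weakened : ∀ {n m k l} (f : Rec (l + n)) (as : Vec U k) (ρ : Vec U m)
               (us : Vec (Fin (k + m)) l) xs y →
      Sat B (as ++ ρ) (graph f (us ++ wk k xs) y) ⇔
      Computes f (map (lookup (as ++ ρ)) us ++ map (lookup ρ) xs) (lookup (as ++ ρ) y)
    weakened f as ρ us xs y =
      graph-adequate f (as ++ ρ) (us ++ wk _ xs) y ∘⇔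
      ≡⇒⇔ (cong (λ vs → Computes f vs _)
        (trans (map-++ _ us _) (cong (map _ us ++_) (lookup-wk as ρ xs))))

    graphs-adequate : ∀ {n m k} (gs : Vec (Rec n) k) (ρ : Vec U m) xs ys {φ} →
      Sat B ρ (graphs gs xs ys φ) ⇔
      (AllCompute gs (map (lookup ρ) xs) (map (lookup ρ) ys) × Sat B ρ φ)
    graphs-adequate [] ρ xs [] = mk⇔ (tt ,_) proj₂
    graphs-adequate (g ∷ gs) ρ xs (y ∷ ys) =
      (graph-adequate g ρ xs y ×-⇔ graphs-adequate gs ρ xs ys) ∘⇔
      mk⇔ (λ (p , q , r) → (p , q) , r) (λ ((p , q) , r) → p , q , r)

  -- Soundness: the formulas hold only of correct values

  -- The number that an element stands for is its position in the order, counted from 0.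
  data Rank : U → ℕ → Set where
    least : ∀ {a} → Least a → Rank a 0
    next  : ∀ {a b n} → Rank a n → Next a b → Rank b (suc n)

  module Sound (linear : LinearOrder (λ a b → rel B zero (a ∷ b ∷ []))) where

    open IsTotalOrder linear using (antisym; total; isPartialOrder)
      renaming (refl to ≼-refl; trans to ≼-trans)

    _≼?_ : ∀ a b → Dec (a ≼ b)
    a ≼? b = T? _

    least-has-no-pred : ∀ {a b} → Least b → ¬ Next a b
    least-has-no-pred lb (a≼b , a≢b , _) = a≢b (antisym a≼b (lb _))

    pred-unique : ∀ {a b c} → Next a c → Next b c → a ≡ b
    pred-unique (a≼c , a≢c , ha) (b≼c , b≢c , hb) = antisym
      ([ id , (λ c≼a → contradiction (antisym a≼c c≼a) a≢c) ]′ (hb _))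
      ([ id , (λ c≼b → contradiction (antisym b≼c c≼b) b≢c) ]′ (ha _))

    rank-least : ∀ {a n} → Rank a n → Least a → n ≡ 0
    rank-least (least _)  la = refl
    rank-least (next _ p) la = contradiction p (least-has-no-pred la)

    rank-next : ∀ {a b n} → Rank b n → Next a b → ∃[ k ] n ≡ suc k × Rank a k
    rank-next (least lb)  p = contradiction p (least-has-no-pred lb)
    rank-next (next r q) p with refl ← pred-unique p q = _ , refl , r

    rank-unique : ∀ {a m n} → Rank a m → Rank a n → m ≡ n
    rank-unique (least l)  s = sym (rank-least s l)
    rank-unique (next r p) s with _ , refl , s′ ← rank-next s p = cong suc (rank-unique r s′)

    -- If `b` is not least, start from an element strictly below it and climb as long as something
    -- lies strictly in between. The strict order on a finite set is Noetherian, so the climb ends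
    -- at the predecessor.
    least-or-next : ∀ b → Least b ⊎ ∃[ a ] Next a b
    least-or-next b with Fin.all? (λ a → b ≼? a)
    ... | yes lb  = inj₁ lb
    ... | no  ¬lb with a , b⋠a ← Fin.¬∀⟶∃¬ _ _ (b ≼?_) ¬lb =
      inj₂ (climb a (po-noetherian isPartialOrder a)
        ([ id , (λ b≼a → contradiction b≼a b⋠a) ]′ (total a b)) λ { refl → b⋠a ≼-refl })
      where
      climb : ∀ a → Acc _ a → a ≼ b → a ≢ b → ∃[ c ] Next c b
      climb a (acc rec) a≼b a≢b with Fin.all? (λ c → (c ≼? a) ⊎-dec (b ≼? c))
      ... | yes h = a , a≼b , a≢b , h
      ... | no ¬h with c , ¬p ← Fin.¬∀⟶∃¬ _ _ (λ c → (c ≼? a) ⊎-dec (b ≼? c)) ¬h =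
        climb c (rec (a≼c , a≢c)) c≼b c≢b
        where
        a≼c = [ id , (λ c≼a → contradiction (inj₁ c≼a) ¬p) ]′ (total a c)
        c≼b = [ id , (λ b≼c → contradiction (inj₂ b≼c) ¬p) ]′ (total c b)
        a≢c = λ { refl → ¬p (inj₁ ≼-refl) }
        c≢b = λ { refl → ¬p (inj₂ ≼-refl) }

    ranked : ∀ a → ∃ (Rank a)
    ranked a = go a (po-wellFounded isPartialOrder a)
      where
      go : ∀ a → Acc _ a → ∃ (Rank a)
      go a (acc rec) with least-or-next a
      ... | inj₁ la = 0 , least la
      ... | inj₂ (b , p) with n , r ← go b (rec (proj₁ p , proj₁ (proj₂ p))) = suc n , next r p

    -- Minimisation needs this: every number below the value is represented by an element, to which
    -- the universal clause applies.
    rank-below : ∀ {a n j} → Rank a n → j < n → ∃[ b ] Rank b j × b ≼ a × b ≢ a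
    rank-below (next r (p , q , h)) (s≤s j≤n) with ℕ.m≤n⇒m<n∨m≡n j≤n
    ... | inj₂ refl = _ , r , p , q
    ... | inj₁ j<n with b , rb , b≼ , b≢ ← rank-below r j<n =
      b , rb , ≼-trans b≼ p , λ { refl → b≢ (antisym b≼ p) }

    mutual
      -- This concerns arbitrary finite ordered structures: a small or irregular one may lack the
      -- witnesses for `Computes`, but it never certifies a wrong value.
      sound : ∀ {n} (f : Rec n) {xs y ns} → Computes f xs y → Pointwise Rank xs ns →
              ∃[ k ] Rank y k × f [ ns ]⇓ k
      sound zer  c [] = 0 , least c , zer⇓
      sound succ c (r ∷ []) = _ , next r c , succ⇓
      sound (proj i) refl rs = _ , Pointwise.lookup rs i , proj⇓
      sound (comp f gs) (_ , cs , c) rs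
        with _ , qs , ds ← sounds gs cs rs
        with k , r , d ← sound f c qs = k , r , comp⇓ ds d
      sound (prec f g) (s , k∈ , closed) (r ∷ rs) = sound-prec f g s closed rs r k∈
      sound (mu f) {y = y} ((o , lo , c) , below) rs
        with k , r ← ranked y
        with n , ro , d ← sound f c (r ∷ rs)
        with refl ← rank-least ro lo = k , r , mu⇓ positive d
        where
        positive : ∀ j → j < k → ∃[ v ] f [ j ∷ _ ]⇓ suc v
        positive j j<k
          with b , rb , b≼ , b≢ ← rank-below r j<k
          with v , ¬lv , c ← below b (b≼ , b≢)
          with sound f c (rb ∷ rs)
        ... | zero  , least lv , _ = contradiction lv ¬lv
        ... | suc v , _        , d = v , d

      -- By induction on the rank of `i`: closure justifies a fact at a successor by a fact about
      -- the same `s` at its unique predecessor, so the descent ends at the least element.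
      sound-prec : ∀ {n} (f : Rec n) (g : Rec (2 + n)) {xs ns} s →
        (∀ i v → Fact s i v →
          (Least i × Computes f xs v) ⊎
          (∃[ j ] ∃[ w ] Fact s j w × Next j i × Computes g (j ∷ w ∷ xs) v)) →
        Pointwise Rank xs ns →
        ∀ {i v n} → Rank i n → Fact s i v → ∃[ k ] Rank v k × prec f g [ n ∷ ns ]⇓ k
      sound-prec f g s closed rs {i} {v} {n} ri i∈ with closed i v i∈
      ... | inj₁ (li , c)
        with refl ← rank-least ri li
        with k , r , d ← sound f c rs = k , r , prec⇓0 d
      sound-prec f g s closed rs (least li) i∈ | inj₂ (j , w , j∈ , p , c) =
        contradiction p (least-has-no-pred li)
      sound-prec f g s closed rs (next rj q) i∈ | inj₂ (j , w , j∈ , p , c)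
        with refl ← pred-unique p q
        with _ , rw , d ← sound-prec f g s closed rs rj j∈
        with k , r , e ← sound g c (rj ∷ rw ∷ rs) = k , r , prec⇓s d e

      sounds : ∀ {n k} (gs : Vec (Rec n) k) {xs ys ns} → AllCompute gs xs ys →
        Pointwise Rank xs ns →
        ∃[ ks ] Pointwise Rank ys ks × (∀ i → lookup gs i [ ns ]⇓ lookup ks i)
      sounds [] {ys = []} _ rs = [] , [] , λ ()
      sounds (g ∷ gs) {ys = y ∷ ys} (c , cs) rs
        with k , r , d ← sound g c rs
        with ks , qs , ds ← sounds gs cs rs =
        k ∷ ks , r ∷ qs , λ { zero → d ; (suc i) → ds i }

-- Words that store finite ternary relations

nth : ∀ {A : Set} → List A → ℕ → Maybe A
nth []       _       = nothing
nth (x ∷ xs) zero    = just x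
nth (x ∷ xs) (suc n) = nth xs n

nth-< : ∀ {A : Set} (xs : List A) {n a} → nth xs n ≡ just a → n < length xs
nth-< (x ∷ xs) {zero}  _ = z<s
nth-< (x ∷ xs) {suc n} p = s<s (nth-< xs p)

Triple : Set
Triple = ℕ × ℕ × ℕ

-- The word of a model: padding for the numbers below m, whose letter 3 is no
-- relation of τ, followed by three letters, with the numbers they refer to, for
-- each triple.
letters : List Triple → List (ℕ × ℕ)
letters []                = []
letters ((s , i , v) ∷ L) = (0 , s) ∷ (1 , i) ∷ (2 , v) ∷ letters L

padded : ℕ → List Triple → List (ℕ × ℕ)
padded m L = replicate m (3 , 0) List.++ letters L

Spells : List (ℕ × ℕ) → ℕ → Triple → Set
Spells w p (s , i , v) =
  nth w p ≡ just (0 , s) × nth w (1 + p) ≡ just (1 , i) × nth w (2 + p) ≡ just (2 , v)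

spelled : ∀ m {L t} → t ∈ L → ∃[ p ] Spells (padded m L) p t
spelled zero    (here refl) = 0 , refl , refl , refl
spelled zero    (there t∈)  with p , q ← spelled zero t∈ = 3 + p , q
spelled (suc m) t∈          with p , q ← spelled m t∈ = 1 + p , q

-- The letter 0 occurs only at the start of a block of three, so no spelling begins in the padding
-- or straddles two blocks.
spelled⁻ : ∀ m L {p t} → Spells (padded m L) p t → t ∈ L
spelled⁻ zero (_ ∷ L) {0} (refl , refl , refl) = here refl
spelled⁻ zero (_ ∷ L) {suc (suc (suc p))} q = there (spelled⁻ zero L q)
spelled⁻ zero [] {p} ()
spelled⁻ zero (_ ∷ L) {1} ()
spelled⁻ zero (_ ∷ L) {2} ()
spelled⁻ (suc m) L {suc p} q = spelled⁻ m L q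

-- Worlds, their extensions and their models

toℕ-onto : ∀ {i n} → i < n → ∃[ x ] toℕ {n} x ≡ i
toℕ-onto i<n = fromℕ< i<n , Fin.toℕ-fromℕ< i<n

-- A stage in building a model: the numbers below `bound` are available as values and identifiers.
-- There are always at least two of them; as neither 0 nor 1 is a leaf, the Gaifman graph is
-- disconnected.
record World : Set where
  field
    extra : ℕ
    facts : List Triple
  bound : ℕ
  bound = 2 + extra
  field
    bounded : All (λ (s , i , v) → s < bound × i < bound × v < bound) facts
  word : List (ℕ × ℕ)
  word = padded bound facts

open World

-- An extension adds no facts about old identifiers: the formulas graph f
-- quantify universally over the facts about an identifier, so without this they
-- would not be preserved.
infix 4 _⊑_

record _⊑_ (w w′ : World) : Set where
  field
    bound≤ : bound w ≤ bound w′
    facts⊆ : ∀ {t} → t ∈ facts w → t ∈ facts w′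
    old    : ∀ {s p} → (s , p) ∈ facts w′ → s < bound w → (s , p) ∈ facts w

open _⊑_

⊑-refl : ∀ {w} → w ⊑ w
⊑-refl = record { bound≤ = ℕ.≤-refl ; facts⊆ = id ; old = λ t∈ _ → t∈ }

⊑-trans : ∀ {u v w} → u ⊑ v → v ⊑ w → u ⊑ w
⊑-trans p q = record
  { bound≤ = ℕ.≤-trans (bound≤ p) (bound≤ q)
  ; facts⊆ = facts⊆ q ∘ facts⊆ p
  ; old    = λ t∈ s< → old p (old q t∈ (ℕ.<-≤-trans s< (bound≤ p))) s<
  }

link? : ∀ w (j x y : ℕ) → Dec (nth (word w) x ≡ just (j , y))
link? w j x y = Maybe.≡-dec (Product.≡-dec ℕ._≟_ ℕ._≟_) _ _

-- The elements are the positions of the word: padding positions serve as numbers, and each later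
-- position is a leaf of the number it refers to. The cardinality is written so that the universe is
-- definitionally `Fin (length (word w))`.
model : World → Structure τ
model w = record
  { pred-card = suc (length (padded (extra w) (facts w)))
  ; rel = λ { j (x ∷ y ∷ []) → ⌊ link? w (toℕ j) (toℕ x) (toℕ y) ⌋ }
  }

ascending descending : ∀ {n} → Fin n → Fin n → Bool
ascending  x y = toℕ x ≤ᵇ toℕ y
descending x y = toℕ y ≤ᵇ toℕ x

module In (w : World) where

  open Semantics (expand (model w) ascending) public

  Least-0 : ∀ {a} → toℕ a ≡ 0 → Least a
  Least-0 {zero} refl b = _

  Next-suc : ∀ {a b} → toℕ b ≡ suc (toℕ a) → Next a b
  Next-suc {a} {b} eq =
    ℕ.≤⇒≤ᵇ (subst (toℕ a ≤_) (sym eq) (ℕ.n≤1+n _)) ,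
    (λ { refl → ℕ.1+n≢n (sym eq) }) , λ c → cmp c (ℕ.≤-<-connex (toℕ c) (toℕ a))
    where
    cmp : ∀ c → toℕ c ≤ toℕ a ⊎ toℕ a < toℕ c → c ≼ a ⊎ b ≼ c
    cmp c (inj₁ c≤a) = inj₁ (ℕ.≤⇒≤ᵇ c≤a)
    cmp c (inj₂ a<c) = inj₂ (ℕ.≤⇒≤ᵇ (subst (_≤ toℕ c) (sym eq) a<c))

  Next-suc⁻ : ∀ {a b} → Next a b → toℕ b ≡ suc (toℕ a)
  Next-suc⁻ {a} {b} (a≼b , a≢b , h) = ℕ.≤-antisym b≤1+a a<b
    where
    a<b : toℕ a < toℕ b
    a<b = ℕ.≤∧≢⇒< (ℕ.≤ᵇ⇒≤ _ _ a≼b) (a≢b ∘ Fin.toℕ-injective)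
    1+a< = ℕ.≤-<-trans a<b (Fin.toℕ<n b)
    1+a≡ = Fin.toℕ-fromℕ< 1+a<
    b≤1+a : toℕ b ≤ suc (toℕ a)
    b≤1+a with h (fromℕ< 1+a<)
    ... | inj₁ q = contradiction (subst (_≤ toℕ a) 1+a≡ (ℕ.≤ᵇ⇒≤ _ _ q)) ℕ.1+n≰n
    ... | inj₂ q = subst (toℕ b ≤_) 1+a≡ (ℕ.≤ᵇ⇒≤ _ _ q)

  position : ∀ {p a} → nth (word w) p ≡ just a → ∃[ x ] toℕ {length (word w)} x ≡ p
  position q = toℕ-onto (nth-< (word w) q)

  Link-nth : ∀ x {j y} → nth (word w) (toℕ x) ≡ just (toℕ j , toℕ y) → Link j x y
  Link-nth _ = fromWitness

  Link-nth⁻ : ∀ x {j y} → Link j x y → nth (word w) (toℕ x) ≡ just (toℕ j , toℕ y)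
  Link-nth⁻ _ = toWitness

  Fact-∈ : ∀ {s i v} → (toℕ s , toℕ i , toℕ v) ∈ facts w → Fact s i v
  Fact-∈ t∈
    with p , qs , qi , qv ← spelled (bound w) t∈
    with a , refl ← position {p} qs
    with b , eb ← position {1 + p} qi
    with c , ec ← position {2 + p} qv =
    a , b , c , Link-nth a qs ,
    Link-nth b (subst (λ p → nth (word w) p ≡ _) (sym eb) qi) ,
    Link-nth c (subst (λ p → nth (word w) p ≡ _) (sym ec) qv) ,
    Next-suc eb , Next-suc (trans ec (cong suc (sym eb)))

  Fact-∈⁻ : ∀ {s i v} → Fact s i v → (toℕ s , toℕ i , toℕ v) ∈ facts w
  Fact-∈⁻ (a , b , c , qs , qi , qv , ab , bc) = spelled⁻ (bound w) (facts w)
    ( Link-nth⁻ a qs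
    , subst (λ p → nth (word w) p ≡ _) eb (Link-nth⁻ b qi)
    , subst (λ p → nth (word w) p ≡ _) (trans (Next-suc⁻ bc) (cong suc eb)) (Link-nth⁻ c qv))
    where eb = Next-suc⁻ ab

  element : ∀ {n} → n < bound w → ∃[ a ] toℕ {length (word w)} a ≡ n
  element n< = toℕ-onto (ℕ.<-≤-trans n< bound≤length)
    where
    bound≤length : bound w ≤ length (word w)
    bound≤length = ℕ.≤-trans
      (ℕ.≤-trans (ℕ.≤-reflexive (sym (List.length-replicate (bound w)))) (ℕ.m≤m+n _ _))
      (ℕ.≤-reflexive (sym (List.length-++ (replicate (bound w) (3 , 0)))))

-- Completeness: every computation is witnessed in some world

Values : ∀ {n k} → Vec (Fin k) n → Vec ℕ n → Set
Values = Pointwise (λ x n → toℕ x ≡ n)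

-- Quantifying over all extensions, as in Kripke semantics, builds in preservation when the world
-- grows.
Holds : ∀ {n} → World → Rec n → Vec ℕ n → ℕ → Set
Holds w f ns n = ∀ {w′} → w ⊑ w′ → ∀ {xs y} → Values xs ns → toℕ y ≡ n → In.Computes w′ f xs y

Realised : ∀ {n} → World → Rec n → Vec ℕ n → ℕ → Set
Realised w f ns n = n < bound w × Holds w f ns n

Holds-mono : ∀ {n} {f : Rec n} {w w′ ns k} → w ⊑ w′ → Holds w f ns k → Holds w′ f ns k
Holds-mono p h q = h (⊑-trans p q)

Realised-mono : ∀ {n} {f : Rec n} {w w′ ns k} → w ⊑ w′ → Realised w f ns k → Realised w′ f ns k
Realised-mono {f = f} p (n< , h) = ℕ.<-≤-trans n< (bound≤ p) , Holds-mono {f = f} p h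

grow : ∀ n w → ∃[ w′ ] w ⊑ w′ × n < bound w′
grow n w = w′ , record { bound≤ = b≤ ; facts⊆ = id ; old = λ t∈ _ → t∈ } ,
           ℕ.≤-trans (ℕ.m≤n+m (suc n) 1) (ℕ.+-monoʳ-≤ 2 (ℕ.m≤m+n n _))
  where
  b≤ : bound w ≤ 2 + (n + extra w)
  b≤ = ℕ.+-monoʳ-≤ 2 (ℕ.m≤n+m _ n)
  w′ = record
    { extra   = n + extra w
    ; facts   = facts w
    ; bounded = All.map (λ (p , q , r) → ℕ.<-≤-trans p b≤ , ℕ.<-≤-trans q b≤ , ℕ.<-≤-trans r b≤)
                  (bounded w)
    }

-- Goals met earlier survive later extensions, so finitely many can be met one after another.
collect : ∀ {k} (P : Fin k → World → Set) →
          (∀ i {w w′} → w ⊑ w′ → P i w → P i w′) →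
          (∀ i w → ∃[ w′ ] w ⊑ w′ × P i w′) →
          ∀ w → ∃[ w′ ] w ⊑ w′ × (∀ i → P i w′)
collect {zero}  P mono step w = w , ⊑-refl , λ ()
collect {suc k} P mono step w
  with w₁ , p , a ← step zero w
  with w₂ , q , as ← collect (P ∘ suc) (mono ∘ suc) (step ∘ suc) w₁ =
  w₂ , ⊑-trans p q , λ { zero → mono zero q a ; (suc i) → as i }

-- The closure clause of `Computes (prec f g)`, stated for numbers and for a list `t` in place of
-- the facts about an identifier.
Entry : ∀ {n} → World → Rec n → Rec (2 + n) → Vec ℕ n → List (ℕ × ℕ) → ℕ × ℕ → Set
Entry w f g ns t (i , v) = i < bound w × v < bound w ×
  ((i ≡ 0 × Holds w f ns v) ⊎
   (∃[ j ] ∃[ u ] (j , u) ∈ t × i ≡ suc j × Holds w g (j ∷ u ∷ ns) v))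

Entry-mono : ∀ {n} {f : Rec n} {g w w′ ns t t′ e} → w ⊑ w′ → (∀ {e} → e ∈ t → e ∈ t′) →
             Entry w f g ns t e → Entry w′ f g ns t′ e
Entry-mono {f = f} p sub (i< , v< , inj₁ (z , h)) =
  ℕ.<-≤-trans i< (bound≤ p) , ℕ.<-≤-trans v< (bound≤ p) , inj₁ (z , Holds-mono {f = f} p h)
Entry-mono {g = g} p sub (i< , v< , inj₂ (j , u , m , e , h)) =
  ℕ.<-≤-trans i< (bound≤ p) , ℕ.<-≤-trans v< (bound≤ p) ,
  inj₂ (j , u , sub m , e , Holds-mono {f = g} p h)

-- A history of the recursion is kept outside the world until it is finished, because an extension
-- may not add facts about an identifier already in use.
record Table {n} (w : World) (f : Rec n) (g : Rec (2 + n)) (ns : Vec ℕ n) (k v : ℕ) : Set where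
  field
    table   : List (ℕ × ℕ)
    entries : All (Entry w f g ns table) table
    goal    : (k , v) ∈ table

open Table

-- The identifier of a stored table is the old bound, which no earlier fact mentions.
store : ∀ {n} {f : Rec n} {g w ns k v} → Table w f g ns k v →
        ∃[ w′ ] w ⊑ w′ × Realised w′ (prec f g) (k ∷ ns) v
store {f = f} {g} {w} {ns} {k} {v} tab = w′ , w⊑w′ ,
  ℕ.<-≤-trans (proj₁ (proj₂ (All.lookup (entries tab) (goal tab)))) (ℕ.n≤1+n _) , holds
  where
  new : List Triple
  new = List.map (bound w ,_) (table tab)
  w′ : World
  w′ = record
    { extra   = suc (extra w)
    ; facts   = new List.++ facts w
    ; bounded = All.++⁺
        (All.map⁺ (All.map (λ (i< , v< , _) → ℕ.≤-refl , ℕ.m<n⇒m<1+n i< , ℕ.m<n⇒m<1+n v<)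
          (entries tab)))
        (All.map (λ (p , q , r) → ℕ.m<n⇒m<1+n p , ℕ.m<n⇒m<1+n q , ℕ.m<n⇒m<1+n r) (bounded w))
    }
  stored : ∀ {s i v} → (s , i , v) ∈ new → s ≡ bound w × (i , v) ∈ table tab
  stored t∈ with _ , p∈ , refl ← ∈-map⁻ _ t∈ = refl , p∈
  w⊑w′ : w ⊑ w′
  w⊑w′ = record { bound≤ = ℕ.n≤1+n _ ; facts⊆ = ∈-++⁺ʳ new ; old = old′ }
    where
    old′ : ∀ {s p} → (s , p) ∈ new List.++ facts w → s < bound w → (s , p) ∈ facts w
    old′ t∈ s< with ∈-++⁻ new t∈
    ... | inj₁ t∈new = contradiction (proj₁ (stored t∈new)) (ℕ.<⇒≢ s<)
    ... | inj₂ t∈old = t∈old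
  fresh : ∀ {p} → (bound w , p) ∈ new List.++ facts w → p ∈ table tab
  fresh t∈ with ∈-++⁻ new t∈
  ... | inj₁ t∈new = proj₂ (stored t∈new)
  ... | inj₂ t∈old = contradiction (proj₁ (All.lookup (bounded w) t∈old)) (ℕ.<-irrefl refl)
  holds : Holds w′ (prec f g) (k ∷ ns) v
  holds {w″} p {kₓ ∷ xs} {y} (refl ∷ vs) refl
    with s , es ← In.element w″ (bound≤ p) = s , known (goal tab) , closed
    where
    known : ∀ {i v} → (toℕ i , toℕ v) ∈ table tab → In.Fact w″ s i v
    known e∈ = In.Fact-∈ w″ (facts⊆ p (∈-++⁺ˡ
      (subst (λ z → (z , _) ∈ new) (sym es) (∈-map⁺ (bound w ,_) e∈))))
    closed : ∀ i v → In.Fact w″ s i v → _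
    -- By `old`, a fact about `s` in the later world is already one of `w′`, where the identifier
    -- `bound w` belongs to the new table alone.
    closed i v h
      with All.lookup (entries tab) (fresh (subst (λ z → (z , _) ∈ facts w′) es
             (old p (In.Fact-∈⁻ w″ h) (subst (_< bound w′) (sym es) ℕ.≤-refl))))
    ... | _ , _ , inj₁ (i≡0 , c) = inj₁ (In.Least-0 w″ i≡0 , c (⊑-trans w⊑w′ p) vs refl)
    ... | _ , _ , inj₂ (j , u , e∈ , eq , c)
      with j< , u< , _ ← All.lookup (entries tab) e∈
      with j , refl ← In.element w″ (ℕ.<-≤-trans j< (bound≤ (⊑-trans w⊑w′ p)))
      with u , refl ← In.element w″ (ℕ.<-≤-trans u< (bound≤ (⊑-trans w⊑w′ p))) =
      inj₂ (j , u , known e∈ , In.Next-suc w″ eq , c (⊑-trans w⊑w′ p) (refl ∷ refl ∷ vs) refl)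

elements : ∀ w {k} (ns : Vec ℕ k) → (∀ i → lookup ns i < bound w) →
           ∃[ xs ] Values {k = length (word w)} xs ns
elements w []       _  = [] , []
elements w (n ∷ ns) h
  with x , e ← In.element w (h zero)
  with xs , es ← elements w ns (h ∘ suc) = x ∷ xs , e ∷ es

all-compute : ∀ {n k} w (gs : Vec (Rec n) k) {xs ys} →
  (∀ i → In.Computes w (lookup gs i) xs (lookup ys i)) → In.AllCompute w gs xs ys
all-compute w []       {ys = []}    h = _
all-compute w (g ∷ gs) {ys = _ ∷ _} h = h zero , all-compute w gs (h ∘ suc)

mutual
  -- By induction on the derivation. Each subcomputation extends the world left by the previous
  -- ones, whose results persist; a recursion finally stores its table.
  complete : ∀ {n} {f : Rec n} {ns k} → f [ ns ]⇓ k → ∀ w →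
             ∃[ w′ ] w ⊑ w′ × Realised w′ f ns k
  complete zer⇓ w = w , ⊑-refl , z<s , λ { {w″} p [] e → In.Least-0 w″ e }
  complete (succ⇓ {x}) w with w′ , p , b ← grow (suc x) w =
    w′ , p , b , λ { {w″} q (refl ∷ []) e → In.Next-suc w″ e }
  complete (proj⇓ {i = i} {xs = ns}) w with w′ , p , b ← grow (lookup ns i) w =
    w′ , p , b , λ { {w″} q vs e → Fin.toℕ-injective (trans e (sym (Pointwise.lookup vs i))) }
  complete (comp⇓ {f = f} {gs = gs} {ys = ys} ds d) w
    with w₁ , p , rs ← collect (λ i w → Realised w (lookup gs i) _ (lookup ys i))
           (λ i → Realised-mono {f = lookup gs i}) (λ i → complete (ds i)) w
    with w₂ , q , b , h ← complete d w₁ =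
    w₂ , ⊑-trans p q , b , λ {w″} r vs e →
      let zs , es = elements w″ ys (λ i → ℕ.<-≤-trans (proj₁ (rs i)) (bound≤ (⊑-trans q r))) in
      zs , all-compute w″ gs (λ i → proj₂ (rs i) (⊑-trans q r) vs (Pointwise.lookup es i)) ,
      h r es e
  complete (prec⇓0 d) w with w₁ , p , t ← tabulated (prec⇓0 d) w
                        with w₂ , q , r ← store t = w₂ , ⊑-trans p q , r
  complete (prec⇓s d e) w with w₁ , p , t ← tabulated (prec⇓s d e) w
                          with w₂ , q , r ← store t = w₂ , ⊑-trans p q , r
  complete (mu⇓ {f = f} {xs = ns} {k} hs d) w
    -- The computation at `k` has value 0, so realising it makes no room for `k` itself.
    with w₀ , o , b ← grow k w
    with w₁ , p , rs ← collect {k}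
           (λ i w → Realised w f (toℕ i ∷ ns) (suc (proj₁ (hs (toℕ i) (Fin.toℕ<n i)))))
           (λ i → Realised-mono {f = f}) (λ i → complete (proj₂ (hs (toℕ i) (Fin.toℕ<n i)))) w₀
    with w₂ , q , _ , h ← complete d w₁ =
    w₂ , ⊑-trans o (⊑-trans p q) , ℕ.<-≤-trans b (bound≤ (⊑-trans p q)) , holds
    where
    holds : Holds w₂ (mu f) ns k
    holds {w″} r {xs} {y} vs refl =
      (zero , In.Least-0 w″ refl , h r (refl ∷ vs) refl) , below
      where
      below : ∀ j → _ → _
      below j (j≼y , j≢y)
        with i , ei ← toℕ-onto (ℕ.≤∧≢⇒< (ℕ.≤ᵇ⇒≤ _ _ j≼y) (j≢y ∘ Fin.toℕ-injective))
        with b , h ← rs i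
        with v , ev ← In.element w″ (ℕ.<-≤-trans b (bound≤ (⊑-trans q r))) =
        v , (λ lv → contradiction (trans (sym ev) (ℕ.n≤0⇒n≡0 (ℕ.≤ᵇ⇒≤ _ _ (lv zero)))) λ ()) ,
        h (⊑-trans q r) (sym ei ∷ vs) ev

  tabulated : ∀ {n} {f : Rec n} {g k ns v} → prec f g [ k ∷ ns ]⇓ v → ∀ w →
              ∃[ w′ ] w ⊑ w′ × Table w′ f g ns k v
  tabulated (prec⇓0 d) w with w′ , p , b , h ← complete d w =
    w′ , p , record
      { table   = _ ∷ []
      ; entries = (z<s , b , inj₁ (refl , h)) ∷ []
      ; goal    = here refl
      }
  tabulated (prec⇓s {f = f} {g} {k} {xs = ns} d e) w
    with w₁ , p , t ← tabulated d w
    with w₂ , q , k< ← grow (suc k) w₁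
    with w₃ , r , b , h ← complete e w₂ =
    w₃ , ⊑-trans p (⊑-trans q r) , record
      { table   = _ ∷ table t
      ; entries = (ℕ.<-≤-trans k< (bound≤ r) , b , inj₂ (k , _ , there (goal t) , refl , h)) ∷
                  All.map (λ {e} → Entry-mono {f = f} {g} {e = e} (⊑-trans q r) there) (entries t)
      ; goal    = here refl
      }

-- Tree-depth of star forests

x∉p-x : ∀ {n} (p : Subset n) x → ¬ (x ∈ˢ p - x)
x∉p-x (_ ∷ p) zero    ()
x∉p-x (_ ∷ p) (suc x) (Vec.there h) = x∉p-x p x h

other-element : ∀ {n} {S : Subset n} {v} → v ∈ˢ S → ∣ S ∣ ≢ 1 → ∃[ u ] u ∈ˢ S × u ≢ v
other-element {S = S} {v} v∈ size with nonempty? (S - v)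
... | yes (u , u∈) = u , p─q⊆p S _ u∈ , λ { refl → x∉p-x S v u∈ }
... | no  empty    = contradiction
  (trans (cong ∣_∣ (⊆-antisym only
    λ x∈ → subst (_∈ˢ S) (sym (x∈⁅y⁆⇒x≡y v x∈)) v∈)) (∣⁅x⁆∣≡1 v)) size
  where
  only : ∀ {x} → x ∈ˢ S → x ∈ˢ ⁅ v ⁆
  only {x} x∈ with x Fin.≟ v
  ... | yes refl = x∈⁅x⁆ v
  ... | no  x≢v  = contradiction (x , x∈p∧x≢y⇒x∈p-y x∈ x≢v) empty

two-elements : ∀ {n} {S : Subset n} {u v} → u ∈ˢ S → v ∈ˢ S → u ≢ v → 1 < ∣ S ∣
two-elements u∈ v∈ u≢v = ℕ.<-≤-trans (s<s (ℕ.≤-<-trans z≤n (x∈p⇒∣p-x∣<∣p∣ (x∈p∧x≢y⇒x∈p-y u∈ u≢v))))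
  (x∈p⇒∣p-x∣<∣p∣ v∈)

comprehension : ∀ {n} {P : Fin n → Set} (P? : ∀ x → Dec (P x)) →
                ∃[ S ] (∀ x → x ∈ˢ S ⇔ P x)
comprehension P? = tabulate (λ x → ⌊ P? x ⌋) , λ x → mk⇔
  (λ x∈ → toWitness (from T-≡ (trans (sym (lookup∘tabulate _ x)) ([]=⇒lookup x∈))))
  (λ p → lookup⇒[]= x _ (trans (lookup∘tabulate _ x) (to T-≡ (fromWitness p))))

module _ {n} (G : Graph n) where
  open Graph G

  -- Without edges all components are singletons.
  edgeless-td : ∀ {S v} → v ∈ˢ S → (∀ {x y} → x ∈ˢ S → y ∈ˢ S → ¬ (x ~ y)) → TreeDepth G S 1
  edgeless-td {S} {v} v∈ indep with ∣ S ∣ ℕ.≟ 1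
  ... | yes one = single one
  ... | no ¬one = disconnected ¬connected (λ _ → 1)
    (λ K (c , c∈ , h) → single (component-size K c c∈ h))
    ((⁅ v ⁆ , (v , v∈ , λ w → mk⇔ (λ w∈ → subst (Reachable G S v) (sym (x∈⁅y⁆⇒x≡y v w∈)) ε)
       (λ r → subst (_∈ˢ ⁅ v ⁆) (isolated r) (x∈⁅x⁆ v))) , refl) , λ _ _ → ℕ.≤-refl)
    where
    isolated : ∀ {x y} → Reachable G S x y → x ≡ y
    isolated ε = refl
    isolated ((x∈ , y∈ , x~y) ◅ _) = contradiction x~y (indep x∈ y∈)
    ¬connected : ¬ Connected G S
    ¬connected conn with u , u∈ , u≢v ← other-element v∈ ¬one = u≢v (isolated (conn u∈ v∈))
    component-size : ∀ K c → c ∈ˢ S → (∀ w → w ∈ˢ K ⇔ Reachable G S c w) → ∣ K ∣ ≡ 1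
    component-size K c c∈ h = trans (cong ∣_∣ (⊆-antisym
      (λ {x} x∈ → subst (_∈ˢ ⁅ c ⁆) (isolated (to (h x) x∈)) (x∈⁅x⁆ c))
      (λ {x} x∈ → subst (_∈ˢ K) (sym (x∈⁅y⁆⇒x≡y c x∈)) (from (h c) ε)))) (∣⁅x⁆∣≡1 c)

  -- The hypotheses make the graph a disjoint union of stars and isolated vertices, each leaf having
  -- its centre as parent; `root` sends a vertex to the centre of its star.
  module StarForest (Parent : Fin n → Fin n → Set)
    (parent?       : ∀ x → Dec (∃[ y ] Parent x y))
    (parent-unique : ∀ {x y z} → Parent x y → Parent x z → y ≡ z)
    (parent-orphan : ∀ {x y z} → Parent x y → ¬ Parent y z)
    (parent-edge   : ∀ {x y} → Parent x y → x ~ y)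
    (edge-parent   : ∀ {x y} → x ~ y → Parent x y ⊎ Parent y x) where

    root : Fin n → Fin n
    root x with parent? x
    ... | yes (y , _) = y
    ... | no  _       = x

    root-parent : ∀ {x y} → Parent x y → root x ≡ y
    root-parent {x} p with parent? x
    ... | yes (z , q) = parent-unique q p
    ... | no  none    = contradiction (_ , p) none

    root-orphan : ∀ {x} → (∀ {y} → ¬ Parent x y) → root x ≡ x
    root-orphan {x} none with parent? x
    ... | yes (y , p) = contradiction p none
    ... | no  _       = refl

    root-cases : ∀ x → root x ≡ x ⊎ Parent x (root x)
    root-cases x with parent? x
    ... | yes (y , p) = inj₂ p
    ... | no  _       = inj₁ refl

    root-idem : ∀ x → root (root x) ≡ root x
    root-idem x with root-cases x
    ... | inj₁ eq = cong root eq
    ... | inj₂ p  = root-orphan (parent-orphan p)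

    root-edge : ∀ {x} → root x ≢ x → x ~ root x
    root-edge {x} x-leaf with root-cases x
    ... | inj₁ eq = contradiction eq x-leaf
    ... | inj₂ p  = parent-edge p

    edge-root : ∀ {x y} → x ~ y → root x ≡ y ⊎ root y ≡ x
    edge-root = Sum.map root-parent root-parent ∘ edge-parent

    -- This is the tree-depth only of a set that consists of a centre and some of its leaves;
    -- `TreeDepth` asks for a function on all subsets.
    star-td : Subset n → ℕ
    star-td S with ∣ S ∣ ℕ.≟ 1
    ... | yes _ = 1
    ... | no  _ = 2

    star-td-≥1 : ∀ S → 1 ≤ star-td S
    star-td-≥1 S with ∣ S ∣ ℕ.≟ 1
    ... | yes _ = s≤s z≤n
    ... | no  _ = s≤s z≤n

    star-td-≤2 : ∀ S → star-td S ≤ 2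
    star-td-≤2 S with ∣ S ∣ ℕ.≟ 1
    ... | yes _ = s≤s z≤n
    ... | no  _ = ℕ.≤-refl

    star-td-2 : ∀ S → 1 < ∣ S ∣ → star-td S ≡ 2
    star-td-2 S 1< with ∣ S ∣ ℕ.≟ 1
    ... | yes one = contradiction one (ℕ.>⇒≢ 1<)
    ... | no  _   = refl

    -- Removing the centre leaves an edgeless set, where the minimum 1 is attained. Removing a leaf
    -- leaves a smaller star, whose depth must be derived as well; hence the recursion on the size.
    star : ∀ {S c} → Acc _<_ ∣ S ∣ → root c ≡ c → c ∈ˢ S → (∀ {x} → x ∈ˢ S → root x ≡ c) →
           TreeDepth G S (star-td S)
    star {S} {c} (acc rec) rc c∈ toc with ∣ S ∣ ℕ.≟ 1
    ... | yes one = single one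
    ... | no ¬one with u , u∈ , u≢c ← other-element c∈ ¬one =
      connected conn (two-elements u∈ c∈ u≢c) t t-correct ((c , c∈ , t-c) , λ x _ → t-≥1 x)
      where
      ~c : ∀ {x} → x ∈ˢ S → x ≢ c → x ~ c
      ~c {x} x∈ x≢c with refl ← toc x∈ = root-edge (λ rx≡x → x≢c (sym rx≡x))
      to-c : ∀ {x} → x ∈ˢ S → Reachable G S x c × Reachable G S c x
      to-c {x} x∈ with x Fin.≟ c
      ... | yes refl = ε , ε
      ... | no  x≢c  = (x∈ , c∈ , ~c x∈ x≢c) ◅ ε , (c∈ , x∈ , ~-sym (~c x∈ x≢c)) ◅ ε
      conn : Connected G S
      conn x∈ y∈ = proj₁ (to-c x∈) ◅◅ proj₂ (to-c y∈)
      t : Fin n → ℕ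
      t r with r Fin.≟ c
      ... | yes _ = 1
      ... | no  _ = star-td (S - r)
      t-c : t c ≡ 1
      t-c with c Fin.≟ c
      ... | yes _   = refl
      ... | no  c≢c = contradiction refl c≢c
      t-≥1 : ∀ r → 1 ≤ t r
      t-≥1 r with r Fin.≟ c
      ... | yes _ = ℕ.≤-refl
      ... | no  _ = star-td-≥1 (S - r)
      leaf : ∀ {x} → x ∈ˢ S - c → x ≢ c
      leaf x∈ refl = x∉p-x S c x∈
      t-correct : ∀ r → r ∈ˢ S → TreeDepth G (S - r) (t r)
      t-correct r r∈ with r Fin.≟ c
      ... | yes refl = edgeless-td (x∈p∧x≢y⇒x∈p-y u∈ u≢c) λ x∈ y∈ x~y →
        [ (λ eq → leaf y∈ (trans (sym eq) (toc (p─q⊆p S _ x∈))))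
        , (λ eq → leaf x∈ (trans (sym eq) (toc (p─q⊆p S _ y∈)))) ]′ (edge-root x~y)
      ... | no r≢c = star (rec (x∈p⇒∣p-x∣<∣p∣ r∈)) rc (x∈p∧x≢y⇒x∈p-y c∈ (λ c≡r → r≢c (sym c≡r)))
        (λ x∈ → toc (p─q⊆p S _ x∈))

    reachable-root : ∀ {S x y} → Reachable G S x y → root x ≡ root y
    reachable-root ε = refl
    reachable-root {x = x} ((_ , _ , x~y) ◅ r) = trans (same (edge-root x~y)) (reachable-root r)
      where
      same : ∀ {y} → root x ≡ y ⊎ root y ≡ x → root x ≡ root y
      same (inj₁ refl) = sym (root-idem x)
      same (inj₂ refl) = root-idem _

    to-root : ∀ x → Reachable G ⊤ˢ x (root x) × Reachable G ⊤ˢ (root x) x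
    to-root x with root x Fin.≟ x
    ... | yes eq = subst (λ r → Reachable G ⊤ˢ x r × Reachable G ⊤ˢ r x) (sym eq) (ε , ε)
    ... | no neq = (∈⊤ , ∈⊤ , root-edge neq) ◅ ε , (∈⊤ , ∈⊤ , ~-sym (root-edge neq)) ◅ ε

    -- The orphans `a` and `b` are their own roots and so lie in different components; the component
    -- of the leaf `x` attains the maximum 2.
    forest-td : ∀ {a b x y} → a ≢ b → (∀ {z} → ¬ Parent a z) → (∀ {z} → ¬ Parent b z) →
                Parent x y → TreeDepth G ⊤ˢ 2
    forest-td {a} {b} {x} a≢b a-orphan b-orphan p = disconnected
      (λ conn → a≢b (trans (sym (root-orphan a-orphan))
        (trans (reachable-root (conn ∈⊤ ∈⊤)) (root-orphan b-orphan)))) star-td component-td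
      ((proj₁ K , (x , ∈⊤ , component-of-x) ,
        star-td-2 _ (two-elements (from (proj₂ K _) (root-idem x)) (from (proj₂ K _) refl)
          x-leaf)) ,
       λ S _ → star-td-≤2 S)
      where
      x-leaf : root x ≢ x
      x-leaf eq = parent-orphan p (subst (λ z → Parent z _) (trans (sym eq) (root-parent p)) p)
      K = comprehension (λ w → root w Fin.≟ root x)
      component-of-x : ∀ w → w ∈ˢ proj₁ K ⇔ Reachable G ⊤ˢ x w
      component-of-x w = mk⇔
        (λ w∈ → proj₁ (to-root x) ◅◅
          subst (λ r → Reachable G ⊤ˢ r w) (to (proj₂ K w) w∈) (proj₂ (to-root w)))
        (λ r → from (proj₂ K w) (sym (reachable-root r)))
      component-td : ∀ S → Component G ⊤ˢ S → TreeDepth G S (star-td S)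
      component-td S (v , _ , h) = star (<-wellFounded _) (root-idem v)
        (from (h _) (proj₁ (to-root v)))
        (λ {w} w∈ → sym (reachable-root (to (h w) w∈)))

-- Tree-depth of the models

nth-padding : ∀ m L {p} → p < m → nth (padded m L) p ≡ just (3 , 0)
nth-padding (suc m) L {zero}  _         = refl
nth-padding (suc m) L {suc p} (s≤s p<m) = nth-padding m L p<m

nth-bounded : ∀ {b} m {L p j y} → 0 < b → All (λ (s , i , v) → s < b × i < b × v < b) L →
              nth (padded m L) p ≡ just (j , y) → y < b
nth-bounded (suc m) {p = zero}  0<b ts refl = 0<b
nth-bounded (suc m) {p = suc p} 0<b ts eq   = nth-bounded m {p = p} 0<b ts eq
nth-bounded zero {p = 0} 0<b ((h , _ , _) ∷ _) refl = h
nth-bounded zero {p = 1} 0<b ((_ , h , _) ∷ _) refl = h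
nth-bounded zero {p = 2} 0<b ((_ , _ , h) ∷ _) refl = h
nth-bounded zero {p = suc (suc (suc p))} 0<b (_ ∷ ts) eq = nth-bounded zero {p = p} 0<b ts eq
nth-bounded zero {p = 0} 0<b [] ()
nth-bounded zero {p = suc _} 0<b [] ()

module ModelTreeDepth (w : World) where

  open In w

  data Parent (x y : U) : Set where
    via : ∀ j → Link j x y → Parent x y

  parent-unique : ∀ {x y z} → Parent x y → Parent x z → y ≡ z
  parent-unique {x} (via _ p) (via _ q) = Fin.toℕ-injective
    (Product.,-injectiveʳ (Maybe.just-injective (trans (sym (Link-nth⁻ x p)) (Link-nth⁻ x q))))

  number-orphan : ∀ {x y} → toℕ x < bound w → ¬ Parent x y
  number-orphan {x} x< (via j p) = ℕ.<⇒≢ (Fin.toℕ<n j) (Product.,-injectiveˡ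
    (Maybe.just-injective (trans (sym (Link-nth⁻ x p)) (nth-padding (bound w) (facts w) x<))))

  parent-number : ∀ {x y} → Parent x y → toℕ y < bound w
  parent-number {x} (via _ p) = nth-bounded (bound w) {p = toℕ x} z<s (bounded w) (Link-nth⁻ x p)

  parent? : ∀ x → Dec (∃[ y ] Parent x y)
  parent? x = Fin.any? λ y → map′ (λ (j , p) → via j p) (λ { (via j p) → j , p })
    (Fin.any? λ j → T? _)

  parent-edge : ∀ {x y} → Parent x y → Graph._~_ (Gaifman (model w)) x y
  parent-edge {x} {y} (via j p) =
    (λ { refl → number-orphan {x} (parent-number {x} (via j p)) (via j p) }) ,
    j , x ∷ y ∷ [] , p , here refl , there (here refl)

  edge-parent : ∀ {x y} → Graph._~_ (Gaifman (model w)) x y → Parent x y ⊎ Parent y x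
  edge-parent (x≢y , j , _ ∷ _ ∷ [] , p , here refl , here refl) =
    contradiction refl x≢y
  edge-parent (x≢y , j , _ ∷ _ ∷ [] , p , here refl , there (here refl)) =
    inj₁ (via j p)
  edge-parent (x≢y , j , _ ∷ _ ∷ [] , p , there (here refl) , here refl) =
    inj₂ (via j p)
  edge-parent (x≢y , j , _ ∷ _ ∷ [] , p , there (here refl) , there (here refl)) =
    contradiction refl x≢y

  -- The fact yields a leaf, and the numbers 0 and 1 are two orphans, so the depth is exactly 2.
  model-td : (0 , 0 , 0) ∈ facts w → FinTD τ 2 (model w)
  model-td t∈ with a , _ , _ , p , _ ← Fact-∈ {zero} {zero} {zero} t∈ = 2 ,
    StarForest.forest-td (Gaifman (model w)) Parent parent? parent-unique
      (λ p → number-orphan (parent-number p)) parent-edge edge-parent {0F} {1F}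
      (λ ()) (number-orphan z<s) (number-orphan (s<s z<s)) (via {a} 0F p) ,
    ℕ.≤-refl

-- The two orders on a model

ascending-linear : ∀ {n} → LinearOrder (ascending {n})
ascending-linear = record
  { isPartialOrder = record
    { isPreorder = record
      { isEquivalence = isEquivalence
      ; reflexive     = λ { {x} refl → ℕ.≤⇒≤ᵇ (ℕ.≤-refl {toℕ x}) }
      ; trans         = λ {x} {y} {z} p q → ℕ.≤⇒≤ᵇ
          (ℕ.≤-trans (ℕ.≤ᵇ⇒≤ (toℕ x) (toℕ y) p) (ℕ.≤ᵇ⇒≤ (toℕ y) (toℕ z) q))
      }
    ; antisym = λ {x} {y} p q → Fin.toℕ-injective
        (ℕ.≤-antisym (ℕ.≤ᵇ⇒≤ (toℕ x) (toℕ y) p) (ℕ.≤ᵇ⇒≤ (toℕ y) (toℕ x) q))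
    }
  ; total = λ x y → [ inj₁ ∘ ℕ.≤⇒≤ᵇ , inj₂ ∘ ℕ.≤⇒≤ᵇ ]′ (ℕ.≤-total (toℕ x) (toℕ y))
  }

descending-linear : ∀ {n} → LinearOrder (descending {n})
descending-linear = record
  { isPartialOrder = record
    { isPreorder = record
      { isEquivalence = isEquivalence
      ; reflexive     = reflexive ∘ sym
      ; trans         = λ {x} {y} {z} p q → trans′ {z} {y} {x} q p
      }
    ; antisym = λ p q → antisym q p
    }
  ; total = λ x y → Sum.swap (total x y)
  }
  where
  open IsTotalOrder ascending-linear using (reflexive; antisym; total)
    renaming (trans to trans′)

-- Primitive recursive functions on codes

constant : ∀ {n} → ℕ → Rec n
constant zero    = comp zer []
constant (suc a) = comp succ (constant a ∷ [])

constant-⇓ : ∀ {n} {xs : Vec ℕ n} a → constant a [ xs ]⇓ a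
constant-⇓ zero    = comp⇓ {ys = []} (λ ()) zer⇓
constant-⇓ (suc a) = comp⇓ {ys = a ∷ []} (λ { 0F → constant-⇓ a }) succ⇓

comp₂-⇓ : ∀ {n} {f : Rec 2} {g h : Rec n} {xs a b c} →
          g [ xs ]⇓ a → h [ xs ]⇓ b → f [ a ∷ b ∷ [] ]⇓ c → comp f (g ∷ h ∷ []) [ xs ]⇓ c
comp₂-⇓ {a = a} {b} d e = comp⇓ {ys = a ∷ b ∷ []} λ { 0F → d ; 1F → e }

addition : Rec 2
addition = prec (proj 0F) (comp succ (proj 1F ∷ []))

addition-⇓ : ∀ a {b} → addition [ a ∷ b ∷ [] ]⇓ a + b
addition-⇓ zero        = prec⇓0 proj⇓
addition-⇓ (suc a) {b} = prec⇓s (addition-⇓ a) (comp⇓ {ys = a + b ∷ []} (λ { 0F → proj⇓ }) succ⇓)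

triangular : Rec 1
triangular = prec zer (comp addition (comp succ (proj 0F ∷ []) ∷ proj 1F ∷ []))

triangular-⇓ : ∀ n → triangular [ n ∷ [] ]⇓ triangle n
triangular-⇓ zero    = prec⇓0 zer⇓
triangular-⇓ (suc n) = prec⇓s (triangular-⇓ n)
  (comp₂-⇓ (comp⇓ {ys = n ∷ []} (λ { 0F → proj⇓ }) succ⇓) proj⇓ (addition-⇓ (suc n)))

pairing : Rec 2
pairing = comp addition (comp triangular (addition ∷ []) ∷ proj 1F ∷ [])

pairing-⇓ : ∀ a b → pairing [ a ∷ b ∷ [] ]⇓ pair a b
pairing-⇓ a b = comp₂-⇓
  (comp⇓ {ys = a + b ∷ []} (λ { 0F → addition-⇓ a }) (triangular-⇓ (a + b))) proj⇓
  (addition-⇓ (triangle (a + b)))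

pair-of : ∀ {n} → Rec n → Rec n → Rec n
pair-of g h = comp pairing (g ∷ h ∷ [])

pair-of-⇓ : ∀ {n} {g h : Rec n} {xs a b} →
            g [ xs ]⇓ a → h [ xs ]⇓ b → pair-of g h [ xs ]⇓ pair a b
pair-of-⇓ d e = comp₂-⇓ d e (pairing-⇓ _ _)

-- The code of `∃̇ (φ ∧̇ ψ)` for `φ` and `ψ` with codes `a` and `b`; 6 and 3 are the tags of `∃̇`
-- and `∧̇`.
instanceCode : ℕ → ℕ → ℕ
instanceCode a b = pair 6 (pair 3 (pair a b))

instanceOf : ∀ {n} → Rec n → Rec n → Rec n
instanceOf g h = pair-of (constant 6) (pair-of (constant 3) (pair-of g h))

instanceOf-⇓ : ∀ {n} {g h : Rec n} {xs} a b →
               g [ xs ]⇓ a → h [ xs ]⇓ b → instanceOf g h [ xs ]⇓ instanceCode a b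
instanceOf-⇓ a b d e =
  pair-of-⇓ {b = pair 3 (pair a b)} (constant-⇓ 6)
    (pair-of-⇓ {b = pair a b} (constant-⇓ 3) (pair-of-⇓ d e))

module _ (base step : ℕ) where

  -- The parameters `base` and `step` will be the codes of `numeral 0` and of `isNext 0F 1F`.
  numeralCode : ℕ → ℕ
  numeralCode zero    = base
  numeralCode (suc n) = instanceCode step (numeralCode n)

  numeralCoder : Rec 1
  numeralCoder = prec (constant base) (instanceOf (constant step) (proj 1F))

  numeralCoder-⇓ : ∀ n → numeralCoder [ n ∷ [] ]⇓ numeralCode n
  numeralCoder-⇓ zero    = prec⇓0 (constant-⇓ base)
  numeralCoder-⇓ (suc n) =
    prec⇓s (numeralCoder-⇓ n) (instanceOf-⇓ step (numeralCode n) (constant-⇓ step) proj⇓)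

  -- The substitution function of the diagonal argument: it sends the code `n` of a formula to the
  -- code of that formula applied to the numeral of `n`.
  diagonal : Rec 1
  diagonal = instanceOf numeralCoder (proj 0F)

  diagonal-⇓ : ∀ n → diagonal [ n ∷ [] ]⇓ instanceCode (numeralCode n) n
  diagonal-⇓ n = instanceOf-⇓ (numeralCode n) n (numeralCoder-⇓ n) proj⇓

-- Numerals and their codes

-- The code of numeral n does not depend on m, and is a primitive recursive
-- function of n.  The second conjunct fails when the order of a model is reversed.
numeral : ∀ {m} → ℕ → Formula (τ ∪≤) (suc m)
numeral zero    = isLeast 0F ∧̇ (¬̇ (∃̇ link 2F 1F 0F))
numeral (suc n) = ∃̇ (isNext 0F 1F ∧̇ numeral n)

-- A record, so that φ and ψ can be inferred although ⌜_⌝ is not known to be injective.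
infix 4 _≅_
record _≅_ {m n} (φ : Formula (τ ∪≤) m) (ψ : Formula (τ ∪≤) n) : Set where
  constructor same
  field code-≡ : ⌜ φ ⌝ ≡ ⌜ ψ ⌝

open _≅_

module _ {m n : ℕ} where

  leq-≅ : ∀ {x y : Fin m} {x′ y′ : Fin n} →
          toℕ x ≡ toℕ x′ → toℕ y ≡ toℕ y′ → leq x y ≅ leq x′ y′
  leq-≅ p q = same (cong₂ (λ i j → pair 0 (pair 0 (suc (pair i (suc (pair j 0)))))) p q)

  link-≅ : ∀ j {x y : Fin m} {x′ y′ : Fin n} →
           toℕ x ≡ toℕ x′ → toℕ y ≡ toℕ y′ → link j x y ≅ link j x′ y′
  link-≅ r p q = same
    (cong₂ (λ i j → pair 0 (pair (suc (toℕ r)) (suc (pair i (suc (pair j 0)))))) p q)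

  ≐-≅ : ∀ {x y : Fin m} {x′ y′ : Fin n} →
        toℕ x ≡ toℕ x′ → toℕ y ≡ toℕ y′ → x ≐ y ≅ x′ ≐ y′
  ≐-≅ p q = same (cong₂ (λ i j → pair 1 (pair i j)) p q)

  ¬-≅ : ∀ {φ : Formula (τ ∪≤) m} {φ′ : Formula (τ ∪≤) n} → φ ≅ φ′ → ¬̇ φ ≅ ¬̇ φ′
  ¬-≅ (same p) = same (cong (pair 2) p)

  ∧-≅ : ∀ {φ ψ : Formula (τ ∪≤) m} {φ′ ψ′ : Formula (τ ∪≤) n} →
        φ ≅ φ′ → ψ ≅ ψ′ → φ ∧̇ ψ ≅ φ′ ∧̇ ψ′
  ∧-≅ (same p) (same q) = same (cong₂ (λ i j → pair 3 (pair i j)) p q)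

  ∨-≅ : ∀ {φ ψ : Formula (τ ∪≤) m} {φ′ ψ′ : Formula (τ ∪≤) n} →
        φ ≅ φ′ → ψ ≅ ψ′ → φ ∨̇ ψ ≅ φ′ ∨̇ ψ′
  ∨-≅ (same p) (same q) = same (cong₂ (λ i j → pair 4 (pair i j)) p q)

  ∃-≅ : ∀ {φ : Formula (τ ∪≤) (suc m)} {φ′ : Formula (τ ∪≤) (suc n)} → φ ≅ φ′ → (∃̇ φ) ≅ (∃̇ φ′)
  ∃-≅ (same p) = same (cong (pair 6) p)

  ∀-≅ : ∀ {φ : Formula (τ ∪≤) (suc m)} {φ′ : Formula (τ ∪≤) (suc n)} → φ ≅ φ′ → (∀̇ φ) ≅ (∀̇ φ′)
  ∀-≅ (same p) = same (cong (pair 7) p)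

numeral-0-≅ : ∀ {m} → numeral {m} 0 ≅ numeral {0} 0
numeral-0-≅ = ∧-≅ (∀-≅ (leq-≅ refl refl)) (¬-≅ (∃-≅ (link-≅ 2F refl refl)))

isNext-≅ : ∀ {m} → isNext {2 + m} 0F 1F ≅ isNext {2} 0F 1F
isNext-≅ = ∧-≅ (leq-≅ refl refl) (∧-≅ (¬-≅ (≐-≅ refl refl))
  (∀-≅ (∨-≅ (leq-≅ refl refl) (leq-≅ refl refl))))

record HasCode {m} (φ : Formula (τ ∪≤) m) (c : ℕ) : Set where
  constructor has
  field code : ⌜ φ ⌝ ≡ c

open HasCode

UniformCode : ∀ {s} → (∀ m → Formula (τ ∪≤) (s + m)) → Set
UniformCode φ = ∃[ c ] (∀ {m} → HasCode (φ m) c)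

uniform-code : ∀ {s} (φ : ∀ m → Formula (τ ∪≤) (s + m)) → (∀ m → φ m ≅ φ 0) → UniformCode φ
uniform-code φ p = ⌜ φ 0 ⌝ , λ {m} → has (code-≡ (p m))

-- Abstract, lest the type checker evaluate these huge numbers in unary.
abstract

  numeral-0-code : UniformCode {1} (λ m → numeral {m} 0)
  numeral-0-code = uniform-code _ λ m → numeral-0-≅ {m}

  next-code : UniformCode {2} (λ m → isNext {2 + m} 0F 1F)
  next-code = uniform-code _ λ m → isNext-≅ {m}

instance-code : ∀ {m} {φ ψ : Formula (τ ∪≤) (suc m)} a b →
                HasCode φ a → HasCode ψ b → HasCode (∃̇ (φ ∧̇ ψ)) (instanceCode a b)
instance-code _ _ (has refl) (has refl) = has refl

numeralCodeOf : ℕ → ℕ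
numeralCodeOf = numeralCode (proj₁ numeral-0-code) (proj₁ next-code)

numeral-code : ∀ {m} n → HasCode (numeral {m} n) (numeralCodeOf n)
numeral-code zero    = proj₂ numeral-0-code
numeral-code (suc n) =
  instance-code (proj₁ next-code) (numeralCodeOf n) (proj₂ next-code) (numeral-code n)

-- Diagonal sentences

applied : ℕ → Formula (τ ∪≤) 1 → Sentence (τ ∪≤)
applied n φ = ∃̇ (numeral n ∧̇ φ)

applied-code : ∀ n φ → HasCode (applied n φ) (instanceCode (numeralCodeOf n) ⌜ φ ⌝)
applied-code n φ = instance-code (numeralCodeOf n) ⌜ φ ⌝ (numeral-code n) (has refl)

diagonal-code : Rec 1
diagonal-code = diagonal (proj₁ numeral-0-code) (proj₁ next-code)

diagonal-code-⇓ : ∀ φ → diagonal-code [ ⌜ φ ⌝ ∷ [] ]⇓ ⌜ applied ⌜ φ ⌝ φ ⌝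
diagonal-code-⇓ φ = subst (diagonal-code [ ⌜ φ ⌝ ∷ [] ]⇓_)
  (sym (code (applied-code ⌜ φ ⌝ φ))) (diagonal-⇓ _ _ ⌜ φ ⌝)

returns-1 : Rec 1 → Formula (τ ∪≤) 1
returns-1 h = ∃̇ (numeral 1 ∧̇ graph h (1F ∷ []) 0F)

-- Computations and the models of their sentences

module _ {B : Structure (τ ∪≤)} where

  open Semantics B

  numeral-rank : ∀ n {m} (ρ : Vec U (suc m)) → Sat B ρ (numeral n) → Rank (lookup ρ 0F) n
  numeral-rank zero    _ (l , _)     = least l
  numeral-rank (suc n) ρ (a , p , s) = next (numeral-rank n (a ∷ ρ) s) p

  numeral-least : ∀ n {m} {ρ : Vec U (suc m)} → Sat B ρ (numeral n) →
                  ∃[ z ] Least z × ¬ (∃[ y ] Link 2F z y)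
  numeral-least zero    s           = _ , s
  numeral-least (suc n) (_ , _ , s) = numeral-least n s

numeral-sat : ∀ w n {m} (ρ : Vec (In.U w) (suc m)) → n < bound w → toℕ (lookup ρ 0F) ≡ n →
              Sat (expand (model w) ascending) ρ (numeral n)
numeral-sat w zero ρ n< eq = In.Least-0 w eq ,
  λ (y , p) → ModelTreeDepth.number-orphan w {lookup ρ 0F}
    (subst (_< bound w) (sym eq) n<) (ModelTreeDepth.via 2F p)
numeral-sat w (suc n) ρ n< eq
  with b , refl ← In.element w (ℕ.<-trans (ℕ.n<1+n n) n<) =
  b , In.Next-suc w eq , numeral-sat w n (b ∷ ρ) (ℕ.<-trans (ℕ.n<1+n n) n<) refl

module _ {A : Structure τ} {_⊴_ : Universe A → Universe A → Bool} (linear : LinearOrder _⊴_) where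

  open Semantics (expand A _⊴_)
  open Sound linear

  applied-sound : ∀ h n → expand A _⊴_ ⊨ applied n (returns-1 h) → h [ n ∷ [] ]⇓ 1
  applied-sound h n (x , sx , y , sy , s)
    with k , r , d ← sound h (to (graph-adequate h (y ∷ x ∷ []) (1F ∷ []) 0F) s)
                       (numeral-rank n (x ∷ []) sx ∷ [])
    with refl ← rank-unique r (numeral-rank 1 (y ∷ x ∷ []) sy) = d

-- Its dummy fact persists in all extensions: it supplies the edge for `model-td` and a last triple
-- for `last-linked`.
start : World
start = record { extra = 0 ; facts = (0 , 0 , 0) ∷ [] ; bounded = (z<s , z<s , z<s) ∷ [] }

applied-complete : ∀ h n → h [ n ∷ [] ]⇓ 1 →
  ∃[ w ] start ⊑ w × expand (model w) ascending ⊨ applied n (returns-1 h)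
applied-complete h n d
  with w₁ , p , n< ← grow n start
  with w , q , 1< , holds ← complete d w₁
  with n<′ ← ℕ.<-≤-trans n< (bound≤ q)
  with x , ex ← In.element w n<′
  with y , ey ← In.element w 1< =
  w , ⊑-trans p q , x , numeral-sat w n (x ∷ []) n<′ ex , y , numeral-sat w 1 (y ∷ x ∷ []) 1< ey ,
  from (In.graph-adequate w h (y ∷ x ∷ []) (1F ∷ []) 0F) (holds ⊑-refl (ex ∷ []) ey)

-- Reversing the order of a model

last-letter : ∀ m t L → ∃[ p ] ∃[ v ]
  suc p ≡ length (padded m (t ∷ L)) × nth (padded m (t ∷ L)) p ≡ just (2 , v)
last-letter (suc m) t L with p , v , eq , q ← last-letter m t L = suc p , v , cong suc eq , q
last-letter zero t []       = 2 , _ , refl , refl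
last-letter zero t (t′ ∷ L) with p , v , eq , q ← last-letter zero t′ L =
  3 + p , v , cong (3 +_) eq , q

-- In the reversed order the least element is the last position of the word. As there is a fact, the
-- word ends with the third letter of a triple.
last-linked : ∀ w → (0 , 0 , 0) ∈ facts w → ∀ z →
  Semantics.Least (expand (model w) descending) z → ∃[ y ] In.Link w 2F z y
last-linked w@(record { facts = t ∷ L }) t∈ z l
  with p , v , len , q ← last-letter (bound w) t L
  with z′ , refl ← In.position w {p} q
  with refl ← Fin.toℕ-injective {i = z} {j = z′} (ℕ.≤-antisym
         (ℕ.≤-pred (ℕ.≤-trans (Fin.toℕ<n z) (ℕ.≤-reflexive (sym len))))
         (ℕ.≤ᵇ⇒≤ (toℕ z′) (toℕ z) (l z′)))
  with y , refl ← In.element w (nth-bounded (bound w) {p = p} z<s (bounded w) q) =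
  y , In.Link-nth w z q

descending-refutes : ∀ h n w → (0 , 0 , 0) ∈ facts w →
                     ¬ expand (model w) descending ⊨ applied n (returns-1 h)
descending-refutes h n w t∈ (_ , s , _) =
  let z , l , unlinked = numeral-least n s in unlinked (last-linked w t∈ z l)

-- Undecidability of order-invariance

applied-not-invariant : ∀ h n → h [ n ∷ [] ]⇓ 1 →
  ¬ OrderInvariantOn (FinTD τ 2) (applied n (returns-1 h))
applied-not-invariant h n d invariant =
  let w , p , sat = applied-complete h n d
      t∈ = facts⊆ p (here refl)
  in descending-refutes h n w t∈
       (to (invariant (model w) (ModelTreeDepth.model-td w t∈) ascending descending
              ascending-linear descending-linear) sat)

applied-invariant : ∀ h n → ¬ h [ n ∷ [] ]⇓ 1 →
  OrderInvariantOn (FinTD τ 2) (applied n (returns-1 h))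
applied-invariant h n undef A _ _ _ l₁ l₂ = mk⇔
  (λ s → contradiction (applied-sound l₁ h n s) undef)
  (λ s → contradiction (applied-sound l₂ h n s) undef)

diagonal-⇔ : ∀ f φ → comp f (diagonal-code ∷ []) [ ⌜ φ ⌝ ∷ [] ]⇓ 1 ⇔
                     f [ ⌜ applied ⌜ φ ⌝ φ ⌝ ∷ [] ]⇓ 1
diagonal-⇔ f φ = mk⇔
  (λ { (comp⇓ {ys = a ∷ []} ds d) →
    subst (λ a → f [ a ∷ [] ]⇓ 1) (⇓-deterministic (ds 0F) (diagonal-code-⇓ φ)) d })
  (λ d → comp⇓ {ys = _ ∷ []} (λ { 0F → diagonal-code-⇓ φ }) d)

-- A constructive argument, without case distinction on `P φ`. If `P φ` held, `f` would return 1,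
-- giving `Q` and refuting `P φ`. So `f` returns 0, whence `Q` fails by determinism and `P φ`
-- follows after all.
liar : ∀ {P : Sentence (τ ∪≤) → Set} {Q : Set} {f} φ →
       (Q → ¬ P φ) → (¬ Q → P φ) → Q ⇔ f [ ⌜ φ ⌝ ∷ [] ]⇓ 1 →
       ¬ (∀ φ → (P φ → f [ ⌜ φ ⌝ ∷ [] ]⇓ 1) × (¬ P φ → f [ ⌜ φ ⌝ ∷ [] ]⇓ 0))
liar {P} {f = f} φ Q⇒¬P ¬Q⇒P Q⇔f decides = ¬P (¬Q⇒P λ q →
  contradiction (⇓-deterministic (to Q⇔f q) (proj₂ (decides φ) ¬P)) ℕ.1+n≢0)
  where
  ¬P : ¬ P φ
  ¬P p = Q⇒¬P (from Q⇔f (proj₁ (decides φ) p)) p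

undecided : ∀ f h n → h [ n ∷ [] ]⇓ 1 ⇔ f [ ⌜ applied n (returns-1 h) ⌝ ∷ [] ]⇓ 1 →
  ¬ (∀ φ → (OrderInvariantOn (FinTD τ 2) φ → f [ ⌜ φ ⌝ ∷ [] ]⇓ 1) ×
           (¬ OrderInvariantOn (FinTD τ 2) φ → f [ ⌜ φ ⌝ ∷ [] ]⇓ 0))
undecided f h n = liar (applied n (returns-1 h)) (applied-not-invariant h n) (applied-invariant h n)

theorem5 : ∃[ σ ] ¬ AlgorithmicallyDecidable (OrderInvariantOn (FinTD σ 2))
theorem5 = τ , λ (f , decides) →
  -- On the code of `φ`, `h` runs `f` on the sentence that applies `φ` to its own code; for `φ`
  -- equal to `returns-1 h` this sentence says that `f` accepts it.
  let h = comp f (diagonal-code ∷ [])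
  in undecided f h ⌜ returns-1 h ⌝ (diagonal-⇔ f (returns-1 h)) decides
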